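{- Let $h,u,q$ be positive integers with $h\equiv 2$ or $4\pmod 6$, $u\equiv 0\pmod 3$, $u\ge 6$, and $q$ not divisible by $3$. Suppose there exists a $(u+1)$-GDD of type $q^{u+1}$. Call a positive integer $d$ admissible if $d\equiv h\pmod 3$ and $d\le h(u-1)/2$, and suppose that for every admissible $d$ there exists a 4-GDD of type $h^u d^1$; let $d_{\min}$ be the smallest admissible $d$. Then there exists a 4-GDD of type $(hq)^u m^1$ for every integer $m\equiv hq\pmod 3$ with $q\,d_{\min}\le m\le qh(u-1)/2$.
   Context: For a set $K$ of positive integers, a $K$-GDD (group divisible design) is a triple $(V,\mathcal G,\mathcal B)$ where $V$ is a finite set, $\mathcal G$ is a partition of $V$ into subsets called groups, $\mathcal B$ is a nonempty collection of subsets of $V$ (blocks) with sizes in $K$, such that every pair of points from distinct groups lies in exactly one block and no pair of points from the same group lies in any block. A $k$-GDD means a $\{k\}$-GDD. The type $g_1^{u_1}\cdots g_r^{u_r}$ means exactly $u_i$ groups of size $g_i$ for each $i$; type $h^u d^1$ means $u$ groups of size $h$ and one group of size $d$. -}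

module Defs where

open import Data.Fin.Base using (Fin)
open import Data.Fin.Subset using (Subset; ∣_∣; Nonempty) renaming (_∈_ to _∈ₛ_)
open import Data.List.Base using (List; []; map; concatMap; replicate)
open import Data.List.Membership.Propositional using (_∈_)
open import Data.List.Relation.Binary.Permutation.Propositional using (_↭_)
open import Data.List.Relation.Unary.Unique.Propositional using (Unique)
open import Data.Nat.Base using (ℕ; _*_; _∸_; _/_; _%_; _≤_; _<_)
open import Data.Product using (Σ; _×_; _,_; ∃!)
open import Level using (0ℓ)
open import Relation.Binary.PropositionalEquality.Core using (_≡_; _≢_)
open import Relation.Nullary.Negation.Core using (¬_)
open import Relation.Unary using (Pred; ｛_｝)

-- Finite sets of subsets of Fin v are represented by duplicate-free lists.

record IsPartition {v : ℕ} (𝒢 : List (Subset v)) : Set where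
  field
    distinct : Unique 𝒢
    nonempty : ∀ {G} → G ∈ 𝒢 → Nonempty G
    covers   : ∀ x → ∃! _≡_ (λ G → G ∈ 𝒢 × x ∈ₛ G)

-- K is meant to be a set of positive integers.

record GDD (K : Pred ℕ 0ℓ) : Set where
  field
    v               : ℕ
    groups          : List (Subset v)
    blocks          : List (Subset v)
    partition       : IsPartition groups
    blocks-distinct : Unique blocks
    blocks-nonempty : blocks ≢ []
    block-size      : ∀ {B} → B ∈ blocks → K ∣ B ∣
    distinct-groups : ∀ {G H x y} → G ∈ groups → H ∈ groups → G ≢ H →
                      x ∈ₛ G → y ∈ₛ H →
                      ∃! _≡_ (λ B → B ∈ blocks × x ∈ₛ B × y ∈ₛ B)
    same-group      : ∀ {G x y B} → G ∈ groups → x ∈ₛ G → y ∈ₛ G → x ≢ y →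
                      B ∈ blocks → ¬ (x ∈ₛ B × y ∈ₛ B)

-- (g₁ , u₁) ∷ … ∷ (gᵣ , uᵣ) ∷ [] stands for the type g₁^u₁ ⋯ gᵣ^uᵣ.  Types are
-- compared as multisets of group sizes, so h^u h^1 is the same type as h^(u+1).

GDDType : Set
GDDType = List (ℕ × ℕ)

sizes : GDDType → List ℕ
sizes = concatMap (λ (g , u) → replicate u g)

HasType : ∀ {K} → GDD K → GDDType → Set
HasType D T = map ∣_∣ (GDD.groups D) ↭ sizes T

_-GDD-of-type_ : ℕ → GDDType → Set
k -GDD-of-type T = Σ (GDD ｛ k ｝) (λ D → HasType D T)

-- The bound h(u-1)/2 is an integer whenever h is even, so flooring is harmless.

record Admissible (h u d : ℕ) : Set where
  field
    positive  : 0 < d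
    congruent : d % 3 ≡ h % 3
    bounded   : d ≤ h * (u ∸ 1) / 2

IsLeast : Pred ℕ 0ℓ → Pred ℕ 0ℓ
IsLeast P n = P n × (∀ k → P k → n ≤ k)

-- Wilson's fundamental construction.  A block of the (u+1)-GDD of type q^(u+1)
-- has u + 1 points in distinct groups, so it meets every group once.  Give
-- weight h to the points of all groups but one, and admissible weights d to the
-- q points of the remaining group; replacing each block by a 4-GDD of type
-- h^u d^1 gives a 4-GDD of type (hq)^u m^1, where m is the sum of the weights d.
-- Since h(u-1)/2 ≡ h (mod 3), the admissible numbers that are used are exactly
-- dmin, dmin + 3, …, h(u-1)/2, and the sums of q of them are all the required m.

module Submission where

open import Defs
open import Data.Fin.Base using (Fin; zero; suc; fromℕ<; punchOut)
open import Data.Fin.Properties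
  using (_≟_; any?; suc-injective; punchOut-injective; injective⇒≤; <⇒notInjective; +↔⊎)
open import Data.Fin.Subset using (Subset; ∣_∣; inside; outside) renaming (_∈_ to _∈ₛ_)
open import Data.List.Base
  using (List; []; _∷_; map; concatMap; replicate; tabulate; allFin; deduplicate; length;
         lookup)
open import Data.List.Membership.Propositional using (_∈_; lose)
open import Data.List.Membership.Propositional.Properties
  using (∈-map⁺; ∈-map⁻; ∈-concatMap⁺; ∈-tabulate⁺; ∈-tabulate⁻; ∈-allFin; ∈-lookup;
         ∈-deduplicate⁺; ∈-deduplicate⁻)
open import Data.List.Properties
  using (map-tabulate; tabulate-cong; tabulate-lookup; ∷-injective; ++-identityʳ)
open import Data.List.Relation.Binary.Permutation.Propositional
  using (_↭_; ↭-sym; ↭-trans; ↭-reflexive; ↭⇒↭ₛ)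
open import Data.List.Relation.Binary.Permutation.Propositional.Properties
  using (↭-map-inv; ∈-resp-↭; ++-comm)
open import Data.List.Relation.Binary.Permutation.Setoid.Properties using (Unique-resp-↭)
open import Data.List.Relation.Unary.All.Properties
  using () renaming (tabulate⁻ to All-tabulate⁻)
open import Data.List.Relation.Unary.AllPairs using () renaming (_∷_ to _∷ᵘ_)
open import Data.List.Relation.Unary.Any using (index)
open import Data.List.Relation.Unary.Any.Properties using (lookup-index)
open import Data.List.Relation.Unary.Unique.DecPropositional.Properties using (deduplicate-!)
open import Data.List.Relation.Unary.Unique.Propositional using (Unique)
open import Data.List.Relation.Unary.Unique.Propositional.Properties
  using () renaming (tabulate⁺ to Unique-tabulate⁺)
open import Data.Nat.Base using (ℕ; zero; suc; _+_; _*_; _∸_; _/_; _%_; _≤_; _<_; _⊓_)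
open import Data.Nat.Divisibility.Core using (_∣_)
open import Data.Nat.DivMod
  using (m≡m%n+[m/n]*n; [m+kn]%n≡m%n; m*n/n≡m; /-monoˡ-≤; %-distribˡ-*)
open import Data.Nat.Properties
  using (+-0-commutativeMonoid; +-comm; *-comm; *-assoc; *-distribˡ-+; *-monoˡ-≤;
         *-cancelʳ-≤; +-cancelˡ-≤; +-monoʳ-≤; m≤m+n; m+[n∸m]≡n; m⊓n+n∸m≡n; m⊓n≤m;
         m≤n+o⇒m∸n≤o; n≤0⇒n≡0; n<1+n; ≤-antisym; <-≤-trans; module ≤-Reasoning)
open import Data.Nat.Tactic.RingSolver using (solve-∀)
open import Algebra.Properties.CommutativeMonoid.Sum +-0-commutativeMonoid using (sum)
open import Data.Product using (Σ; ∃; _×_; _,_; proj₁; proj₂; ∃!)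
open import Data.Product.Function.Dependent.Propositional using () renaming (cong to Σ-cong)
open import Data.Sum.Base using (_⊎_; inj₁; inj₂)
open import Data.Sum.Function.Propositional using (_⊎-cong_)
open import Data.Vec.Base using ([]; _∷_; here; there) renaming (tabulate to vtabulate)
open import Data.Vec.Properties using (lookup⇒[]=; []=⇒lookup; lookup∘tabulate; ≡-dec)
open import Data.Bool.Properties using () renaming (_≟_ to _≟ᵇ_)
open import Function.Base using (_∘_; const)
open import Function.Bundles using (_↔_; mk↔ₛ′; Inverse)
open import Function.Construct.Composition using (_↔-∘_)
open import Function.Construct.Identity using (↔-id)
open import Function.Definitions using (Injective)
open import Level using (0ℓ)
open import Relation.Binary.PropositionalEquality
  using (_≡_; _≢_; refl; sym; trans; cong; cong₂; subst; setoid; module ≡-Reasoning)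
open import Relation.Nullary.Decidable using (yes; no; does; dec-true)
open import Relation.Nullary.Negation.Core using (¬_; contradiction)
open import Relation.Unary using (Pred; Decidable; ｛_｝)

private
  variable
    A : Set
    k m n v : ℕ

-- Enumerations of subsets

-- A numbered listing without repetition of the members of `p`. It serves both to pick the j-th
-- point of a group or block and to compute `∣ p ∣` by exhibiting a listing.
record Enumeration (p : Subset v) (n : ℕ) : Set where
  field
    at        : Fin n → Fin v
    injective : Injective _≡_ _≡_ at
    member    : ∀ j → at j ∈ₛ p
    onto      : ∀ {x} → x ∈ₛ p → ∃ λ j → at j ≡ x

open Enumeration

enumerate : (p : Subset v) → Enumeration p ∣ p ∣
enumerate [] = record
  { at = λ () ; injective = λ {i} → λ { {()} } ; member = λ () ; onto = λ () }
enumerate (outside ∷ p) = record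
  { at        = suc ∘ at E
  ; injective = injective E ∘ suc-injective
  ; member    = (λ j → there (member E j))
  ; onto      = λ { (there x∈p) → let j , eq = onto E x∈p in j , cong suc eq }
  }
  where E = enumerate p
enumerate (inside ∷ p) = record
  { at        = at′
  ; injective = injective′
  ; member    = λ { zero → here ; (suc j) → there (member E j) }
  ; onto      = λ { here        → zero , refl
                  ; (there x∈p) → let j , eq = onto E x∈p in suc j , cong suc eq }
  }
  where
  E = enumerate p

  at′ : Fin (suc ∣ p ∣) → Fin _
  at′ zero    = zero
  at′ (suc j) = suc (at E j)

  injective′ : Injective _≡_ _≡_ at′
  injective′ {zero}  {zero}  eq = refl
  injective′ {suc _} {suc _} eq = cong suc (injective E (suc-injective eq))

-- Sending an index of `E` to the index in `F` of the same element is injective, so the pigeonhole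
-- principle applies.
enumeration-≤ : {p : Subset v} → Enumeration p m → Enumeration p n → m ≤ n
enumeration-≤ E F = injective⇒≤ {f = λ i → proj₁ (onto F (member E i))} λ {i} {j} eq →
  injective E (trans (sym (proj₂ (onto F (member E i))))
                     (trans (cong (at F) eq) (proj₂ (onto F (member E j)))))

enumeration⇒∣p∣≡n : {p : Subset v} → Enumeration p n → ∣ p ∣ ≡ n
enumeration⇒∣p∣≡n {p = p} E =
  ≤-antisym (enumeration-≤ (enumerate p) E) (enumeration-≤ E (enumerate p))

module _ {P : Pred (Fin v) 0ℓ} (P? : Decidable P) where

  comprehension : Subset v
  comprehension = vtabulate (does ∘ P?)

  ∈-comprehension⁺ : ∀ {x} → P x → x ∈ₛ comprehension
  ∈-comprehension⁺ {x} px = lookup⇒[]= x comprehension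
    (trans (lookup∘tabulate (does ∘ P?) x) (dec-true (P? x) px))

  ∈-comprehension⁻ : ∀ {x} → x ∈ₛ comprehension → P x
  ∈-comprehension⁻ {x} x∈ with P? x | trans (sym (lookup∘tabulate (does ∘ P?) x)) ([]=⇒lookup x∈)
  ... | yes px | _ = px

-- Lists

Unique-tabulate⁻ : {f : Fin n → A} → Unique (tabulate f) → Injective _≡_ _≡_ f
Unique-tabulate⁻ (_   ∷ᵘ _) {zero}  {zero}  eq = refl
Unique-tabulate⁻ (f0≢ ∷ᵘ _) {zero}  {suc j} eq = contradiction eq (All-tabulate⁻ f0≢ j)
Unique-tabulate⁻ (f0≢ ∷ᵘ _) {suc i} {zero}  eq = contradiction (sym eq) (All-tabulate⁻ f0≢ i)
Unique-tabulate⁻ (_   ∷ᵘ u) {suc i} {suc j} eq = cong suc (Unique-tabulate⁻ u eq)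

lookup-injective : {xs : List A} → Unique xs → Injective _≡_ _≡_ (lookup xs)
lookup-injective {xs = xs} = Unique-tabulate⁻ ∘ subst Unique (sym (tabulate-lookup xs))

nonempty-index : {xs : List A} → xs ≢ [] → Fin (length xs)
nonempty-index {xs = []}    ne = contradiction refl ne
nonempty-index {xs = _ ∷ _} ne = zero

-- Turns an indexing of the group sizes into an indexing of the groups themselves, with sizes in the
-- prescribed order.
tabulate≡map⁻ : (f : A → ℕ) (xs : List A) {s : Fin n → ℕ} → tabulate s ≡ map f xs →
                ∃ λ (g : Fin n → A) → xs ≡ tabulate g × (∀ i → s i ≡ f (g i))
tabulate≡map⁻ {n = zero}  f []       eq = (λ ()) , refl , λ ()
tabulate≡map⁻ {n = suc n} f (x ∷ xs) eq with ∷-injective eq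
... | eq₀ , eqs with tabulate≡map⁻ f xs eqs
... | g , refl , sg = (λ { zero → x ; (suc i) → g i }) , refl , λ { zero → eq₀ ; (suc i) → sg i }

tabulate-const : ∀ n (x : A) → tabulate {n = n} (const x) ≡ replicate n x
tabulate-const zero    x = refl
tabulate-const (suc n) x = cong (x ∷_) (tabulate-const n x)

sizes-const : ∀ n g → sizes ((g , n) ∷ []) ↭ tabulate {n = n} (const g)
sizes-const n g = ↭-reflexive (trans (++-identityʳ _) (sym (tabulate-const n g)))

-- The exceptional group moves to the front, so that it has index `zero` and sizes can be given by
-- cases on `zero` and `suc`.
sizes-h^u-d^1 : ∀ {h d} (s : Fin (suc n) → ℕ) → s zero ≡ d → (∀ i → s (suc i) ≡ h) →
                sizes ((h , n) ∷ (d , 1) ∷ []) ↭ tabulate s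
sizes-h^u-d^1 {n} {h} {d} s refl eqs = ↭-trans (++-comm (replicate n h) (d ∷ []))
  (↭-reflexive (cong (d ∷_) (trans (sym (tabulate-const n h)) (tabulate-cong (sym ∘ eqs)))))

-- Designs on a disjoint union of groups

-- A point is a group index together with an element of that group, so the partition into groups
-- holds by construction. Blocks are abstract names with `k` numbered points, which lets the blocks
-- of the inflated design be dependent pairs instead of subsets.
record Design (k : ℕ) {n : ℕ} (P : Fin n → Set) : Set₁ where
  field
    Block      : Set
    enum       : List Block
    complete   : ∀ B → B ∈ enum
    inhabitant : Block
    point      : Block → Fin k → Σ (Fin n) P
    transverse : ∀ B → Injective _≡_ _≡_ (proj₁ ∘ point B)

  _∋_ : Block → Σ (Fin n) P → Set
  B ∋ x = ∃ λ j → point B j ≡ x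

  field
    join   : ∀ x y → proj₁ x ≢ proj₁ y → ∃ λ B → B ∋ x × B ∋ y
    unique : ∀ {x y B B′} → proj₁ x ≢ proj₁ y →
             B ∋ x → B ∋ y → B′ ∋ x → B′ ∋ y → B ≡ B′

-- Indexed form of a given GDD

module FromGDD (D : GDD ｛ k ｝) {s : Fin n → ℕ} (type : map ∣_∣ (GDD.groups D) ↭ tabulate s) where
  open GDD D renaming (v to order)
  open IsPartition partition

  private
    -- A permutation of the sizes lifts to a permutation of the groups, which can then be indexed in
    -- the order of `s`.
    permuted = ↭-map-inv ∣_∣ type
    ordered  = tabulate≡map⁻ ∣_∣ (proj₁ permuted) (proj₁ (proj₂ permuted))

    group : Fin n → Subset order
    group = proj₁ ordered

    groups↭ : groups ↭ tabulate group
    groups↭ = ↭-trans (proj₂ (proj₂ permuted)) (↭-reflexive (proj₁ (proj₂ ordered)))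

    group-injective : Injective _≡_ _≡_ group
    group-injective = Unique-tabulate⁻ (Unique-resp-↭ (setoid _) (↭⇒↭ₛ groups↭) distinct)

    group∈ : ∀ i → group i ∈ groups
    group∈ i = ∈-resp-↭ (↭-sym groups↭) (∈-tabulate⁺ i)

    inGroup : ∀ i → Enumeration (group i) (s i)
    inGroup i = subst (Enumeration (group i)) (sym (proj₂ (proj₂ ordered) i)) (enumerate (group i))

    inBlock : ∀ b → Enumeration (lookup blocks b) k
    inBlock b = subst (Enumeration _) (sym (block-size (∈-lookup b))) (enumerate _)

    vertex : Σ (Fin n) (Fin ∘ s) → Fin order
    vertex (i , j) = at (inGroup i) j

    vertex∈ : ∀ z → vertex z ∈ₛ group (proj₁ z)
    vertex∈ (i , j) = member (inGroup i) j

    locate : ∀ x → ∃ λ z → vertex z ≡ x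
    locate x =
      let G , (G∈ , x∈G) , _ = covers x
          i , G≡             = ∈-tabulate⁻ (∈-resp-↭ groups↭ G∈)
          j , eq             = onto (inGroup i) (subst (x ∈ₛ_) G≡ x∈G)
      in (i , j) , eq

    vertex-injective : Injective _≡_ _≡_ vertex
    vertex-injective {i , j} {i′ , j′} eq with group-injective group≡
      where
      -- A point lies in only one group, so the two groups containing the common vertex coincide.
      cov = proj₂ (proj₂ (covers (vertex (i , j))))
      group≡ : group i ≡ group i′
      group≡ = trans (sym (cov (group∈ i , vertex∈ (i , j))))
        (cov (group∈ i′ , subst (_∈ₛ group i′) (sym eq) (vertex∈ (i′ , j′))))
    ... | refl = cong (i ,_) (injective (inGroup i) eq)

    point′ : Fin _ → Fin k → Σ (Fin n) (Fin ∘ s)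
    point′ b j = proj₁ (locate (at (inBlock b) j))

    vertex-point : ∀ b j → vertex (point′ b j) ≡ at (inBlock b) j
    vertex-point b j = proj₂ (locate (at (inBlock b) j))

    -- Two different points of a block with the same group index would be a pair that `same-group`
    -- forbids.
    transverse′ : ∀ b → Injective _≡_ _≡_ (proj₁ ∘ point′ b)
    transverse′ b {j} {j′} eq with at (inBlock b) j ≟ at (inBlock b) j′
    ... | yes x≡x′ = injective (inBlock b) x≡x′
    ... | no  x≢x′ = contradiction
      (member (inBlock b) j , member (inBlock b) j′)
      (same-group (group∈ _) (in-group j)
        (subst (λ i → at (inBlock b) j′ ∈ₛ group i) (sym eq) (in-group j′))
        x≢x′ (∈-lookup b))
      where
      in-group : ∀ j → at (inBlock b) j ∈ₛ group (proj₁ (point′ b j))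
      in-group j = subst (_∈ₛ group (proj₁ (point′ b j))) (vertex-point b j) (vertex∈ (point′ b j))

    ∋⇒∈ : ∀ {b z} → (∃ λ j → point′ b j ≡ z) → vertex z ∈ₛ lookup blocks b
    ∋⇒∈ {b} (j , refl) = subst (_∈ₛ _) (sym (vertex-point b j)) (member (inBlock b) j)

    ∈⇒∋ : ∀ {b z} → vertex z ∈ₛ lookup blocks b → ∃ λ j → point′ b j ≡ z
    ∈⇒∋ {b} z∈ = let j , eq = onto (inBlock b) z∈ in
      j , vertex-injective (trans (vertex-point b j) eq)

    joining : ∀ x y → proj₁ x ≢ proj₁ y →
              ∃! _≡_ (λ B → B ∈ blocks × vertex x ∈ₛ B × vertex y ∈ₛ B)
    joining x y x≢y = distinct-groups (group∈ _) (group∈ _) (x≢y ∘ group-injective)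
                        (vertex∈ x) (vertex∈ y)

  design : Design k (Fin ∘ s)
  design = record
    { Block      = Fin _
    ; enum       = allFin _
    ; complete   = ∈-allFin
    ; inhabitant = nonempty-index blocks-nonempty
    ; point      = point′
    ; transverse = transverse′
    ; join       = λ x y x≢y →
        let B , (B∈ , x∈ , y∈) , _ = joining x y x≢y
            B≡ = lookup-index B∈
        in index B∈ , ∈⇒∋ (subst (_ ∈ₛ_) B≡ x∈) , ∈⇒∋ (subst (_ ∈ₛ_) B≡ y∈)
    ; unique     = λ {x} {y} x≢y b∋x b∋y b′∋x b′∋y →
        let uniq = proj₂ (proj₂ (joining x y x≢y))
        in lookup-injective blocks-distinct
             (trans (sym (uniq (∈-lookup _ , ∋⇒∈ b∋x , ∋⇒∈ b∋y)))
                    (uniq (∈-lookup _ , ∋⇒∈ b′∋x , ∋⇒∈ b′∋y)))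
    }

-- Return from an indexed design to a GDD

Σ-Fin↔ : (s : Fin n → ℕ) → Fin (sum s) ↔ Σ (Fin n) (Fin ∘ s)
Σ-Fin↔ {zero}  s = mk↔ₛ′ (λ ()) (λ ()) (λ ()) (λ ())
Σ-Fin↔ {suc n} s = unfold ↔-∘ ((↔-id _ ⊎-cong Σ-Fin↔ (s ∘ suc)) ↔-∘ +↔⊎)
  where
  unfold : (Fin (s zero) ⊎ Σ (Fin n) (Fin ∘ s ∘ suc)) ↔ Σ (Fin (suc n)) (Fin ∘ s)
  unfold = mk↔ₛ′
    (λ { (inj₁ x) → zero , x ; (inj₂ (i , x)) → suc i , x })
    (λ { (zero , x) → inj₁ x ; (suc i , x) → inj₂ (i , x) })
    (λ { (zero , x) → refl ; (suc i , x) → refl })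
    (λ { (inj₁ x) → refl ; (inj₂ (i , x)) → refl })

-- Nonemptiness of each `P i` also keeps groups with different indices distinct as subsets, since a
-- point of one cannot lie in the other.
module ToGDD {P : Fin n → Set} (D : Design k P) {s : Fin n → ℕ}
             (P↔ : ∀ i → Fin (s i) ↔ P i) (nonempty : ∀ i → P i) where
  open Design D

  private
    vertices : Fin (sum s) ↔ Σ (Fin n) P
    vertices = Σ-cong (↔-id _) (P↔ _) ↔-∘ Σ-Fin↔ s

    open Inverse vertices using (strictlyInverseˡ; strictlyInverseʳ) renaming (to to place; from to vertex)

    place-injective : Injective _≡_ _≡_ place
    place-injective eq = trans (sym (strictlyInverseʳ _)) (trans (cong vertex eq) (strictlyInverseʳ _))

    vertex-injective : Injective _≡_ _≡_ vertex
    vertex-injective eq = trans (sym (strictlyInverseˡ _)) (trans (cong place eq) (strictlyInverseˡ _))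

    inGroup? : ∀ i → Decidable (λ x → proj₁ (place x) ≡ i)
    inGroup? i x = proj₁ (place x) ≟ i

    group : Fin n → Subset (sum s)
    group i = comprehension (inGroup? i)

    ∈group : ∀ {i} z → proj₁ z ≡ i → vertex z ∈ₛ group i
    ∈group {i} z eq = ∈-comprehension⁺ (inGroup? i) (trans (cong proj₁ (strictlyInverseˡ z)) eq)

    group-enumeration : ∀ i → Enumeration (group i) (s i)
    group-enumeration i = record
      { at        = λ j → vertex (i , Inverse.to (P↔ i) j)
      ; injective = λ {j} {j′} eq → to-injective (,-injective (vertex-injective eq))
      ; member    = λ j → ∈group _ refl
      ; onto      = onto′ ∘ ∈-comprehension⁻ (inGroup? i)
      }
      where
      ,-injective : ∀ {p p′ : P i} → (i , p) ≡ (i , p′) → p ≡ p′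
      ,-injective refl = refl

      to-injective : Injective _≡_ _≡_ (Inverse.to (P↔ i))
      to-injective eq = trans (sym (Inverse.strictlyInverseʳ (P↔ i) _))
        (trans (cong (Inverse.from (P↔ i)) eq) (Inverse.strictlyInverseʳ (P↔ i) _))

      onto′ : ∀ {x} → proj₁ (place x) ≡ i → ∃ λ j → vertex (i , Inverse.to (P↔ i) j) ≡ x
      onto′ {x} refl = Inverse.from (P↔ i) (proj₂ (place x)) ,
        trans (cong (λ p → vertex (i , p)) (Inverse.strictlyInverseˡ (P↔ i) _)) (strictlyInverseʳ x)

    inBlock? : ∀ B → Decidable (λ x → ∃ λ j → vertex (point B j) ≡ x)
    inBlock? B x = any? (λ j → vertex (point B j) ≟ x)

    block : Block → Subset (sum s)
    block B = comprehension (inBlock? B)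

    ∈⇒∋ : ∀ {B x} → x ∈ₛ block B → B ∋ place x
    ∈⇒∋ {B} x∈ = let j , eq = ∈-comprehension⁻ (inBlock? B) x∈ in
      j , trans (sym (strictlyInverseˡ _)) (cong place eq)

    ∋⇒∈ : ∀ {B x} → B ∋ place x → x ∈ₛ block B
    ∋⇒∈ {B} (j , eq) = ∈-comprehension⁺ (inBlock? B) (j , trans (cong vertex eq) (strictlyInverseʳ _))

    block-enumeration : ∀ B → Enumeration (block B) k
    block-enumeration B = record
      { at        = vertex ∘ point B
      ; injective = λ eq → transverse B (cong proj₁ (vertex-injective eq))
      ; member    = λ j → ∈-comprehension⁺ (inBlock? B) (j , refl)
      ; onto      = ∈-comprehension⁻ (inBlock? B)
      }

    -- Two names may stand for the same subset when `k` is below 2, where uniqueness on pairs says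
    -- nothing; deduplication gives a repetition-free list for every `k`.
    blocks′ : List (Subset (sum s))
    blocks′ = deduplicate (≡-dec _≟ᵇ_) (map block enum)

    block∈ : ∀ B → block B ∈ blocks′
    block∈ B = ∈-deduplicate⁺ (≡-dec _≟ᵇ_) (∈-map⁺ block (complete B))

    ∈-blocks⁻ : ∀ {S} → S ∈ blocks′ → ∃ λ B → S ≡ block B
    ∈-blocks⁻ S∈ = let B , _ , eq = ∈-map⁻ block (∈-deduplicate⁻ (≡-dec _≟ᵇ_) (map block enum) S∈) in B , eq

    ∈group⇒≡ : ∀ {i i′ x} → x ∈ₛ group i → x ∈ₛ group i′ → i ≡ i′
    ∈group⇒≡ {i} {i′} x∈ x∈′ =
      trans (sym (∈-comprehension⁻ (inGroup? i) x∈)) (∈-comprehension⁻ (inGroup? i′) x∈′)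

    partition′ : IsPartition (tabulate group)
    partition′ = record
      { distinct = Unique-tabulate⁺ λ {i} {i′} eq →
          let x∈ = ∈group (i , nonempty i) refl in
          ∈group⇒≡ x∈ (subst (_ ∈ₛ_) eq x∈)
      ; nonempty = λ G∈ → nonempty′ (∈-tabulate⁻ G∈)
      ; covers   = λ x → let x∈ = ∈-comprehension⁺ (inGroup? (proj₁ (place x))) refl in
          group (proj₁ (place x)) , (∈-tabulate⁺ _ , x∈) , λ { (G∈ , x∈G) → covers′ x∈ (∈-tabulate⁻ G∈) x∈G }
      }
      where
      nonempty′ : ∀ {G} → (∃ λ i → G ≡ group i) → ∃ (_∈ₛ G)
      nonempty′ (i , refl) = vertex (i , nonempty i) , ∈group _ refl

      covers′ : ∀ {i G x} → x ∈ₛ group i → (∃ λ i → G ≡ group i) → x ∈ₛ G → group i ≡ G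
      covers′ x∈ (i′ , refl) x∈′ = cong group (∈group⇒≡ x∈ x∈′)

    distinct-groups′ : ∀ {G H x y} → G ∈ tabulate group → H ∈ tabulate group → G ≢ H →
                       x ∈ₛ G → y ∈ₛ H →
                       ∃! _≡_ (λ B → B ∈ blocks′ × x ∈ₛ B × y ∈ₛ B)
    distinct-groups′ {x = x} {y} G∈ H∈ G≢H x∈ y∈ with ∈-tabulate⁻ G∈ | ∈-tabulate⁻ H∈
    ... | i , refl | i′ , refl =
      let B , B∋x , B∋y = join (place x) (place y) x≢y in
      block B , (block∈ B , ∋⇒∈ B∋x , ∋⇒∈ B∋y) ,
      λ (S∈ , x∈S , y∈S) → uniq B∋x B∋y (∈-blocks⁻ S∈) x∈S y∈S
      where
      x≢y : proj₁ (place x) ≢ proj₁ (place y)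
      x≢y eq = G≢H (cong group (trans (sym (∈-comprehension⁻ (inGroup? i) x∈))
                                      (trans eq (∈-comprehension⁻ (inGroup? i′) y∈))))

      uniq : ∀ {B S} → B ∋ place x → B ∋ place y → (∃ λ B → S ≡ block B) →
             x ∈ₛ S → y ∈ₛ S → block B ≡ S
      uniq B∋x B∋y (B′ , refl) x∈S y∈S = cong block (unique x≢y B∋x B∋y (∈⇒∋ x∈S) (∈⇒∋ y∈S))

    -- The positions of the two points in the block have equal group indices, so transversality
    -- identifies the positions and hence the points.
    same-group′ : ∀ {G x y S} → G ∈ tabulate group → x ∈ₛ G → y ∈ₛ G → x ≢ y →
                  S ∈ blocks′ → ¬ (x ∈ₛ S × y ∈ₛ S)
    same-group′ G∈ x∈ y∈ x≢y S∈ (x∈S , y∈S) with ∈-tabulate⁻ G∈ | ∈-blocks⁻ S∈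
    ... | i , refl | B , refl with ∈⇒∋ x∈S | ∈⇒∋ y∈S
    ... | j , eq | j′ , eq′ = x≢y (place-injective
      (trans (sym eq) (trans (cong (point B) (transverse B j≡j′)) eq′)))
      where
      j≡j′ : proj₁ (point B j) ≡ proj₁ (point B j′)
      j≡j′ = trans (cong proj₁ eq) (trans (∈-comprehension⁻ (inGroup? i) x∈)
               (sym (trans (cong proj₁ eq′) (∈-comprehension⁻ (inGroup? i) y∈))))

  gdd : GDD ｛ k ｝
  gdd = record
    { v               = sum s
    ; groups          = tabulate group
    ; blocks          = blocks′
    ; partition       = partition′
    ; blocks-distinct = deduplicate-! (≡-dec _≟ᵇ_) (map block enum)
    ; blocks-nonempty = λ eq → ¬∈[] (subst (block inhabitant ∈_) eq (block∈ inhabitant))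
    ; block-size      = λ B∈ → size (∈-blocks⁻ B∈)
    ; distinct-groups = distinct-groups′
    ; same-group      = same-group′
    }
    where
    ¬∈[] : ∀ {S : Subset (sum s)} → ¬ (S ∈ [])
    ¬∈[] ()

    size : ∀ {S} → (∃ λ B → S ≡ block B) → k ≡ ∣ S ∣
    size (B , refl) = sym (enumeration⇒∣p∣≡n (block-enumeration B))

  gdd-sizes : map ∣_∣ (GDD.groups gdd) ≡ tabulate s
  gdd-sizes = trans (map-tabulate group ∣_∣)
                    (tabulate-cong (enumeration⇒∣p∣≡n ∘ group-enumeration))

-- Wilson's construction

-- If `i` were missed, deleting it from the codomain would inject `Fin (suc n)` into `Fin n`.
injective⇒surjective : (f : Fin n → Fin n) → Injective _≡_ _≡_ f → ∀ i → ∃ λ j → f j ≡ i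
injective⇒surjective {suc n} f inj i with any? (λ j → f j ≟ i)
... | yes hit = hit
... | no  ¬hit = contradiction
  (λ {j} {j′} eq → inj (punchOut-injective (miss j) (miss j′) eq))
  (<⇒notInjective {f = λ j → punchOut (miss j)} (n<1+n n))
  where
  miss : ∀ j → i ≢ f j
  miss j eq = ¬hit (j , sym eq)

module Inflation {P : Fin n → Set} (D : Design n P) (w : ∀ i → P i → ℕ) where
  private module D = Design D

  -- Block size and number of groups are both `n`, so `D` is a transversal design: the map from
  -- positions to groups is injective, hence onto, and every block has exactly one point in each
  -- group.
  meet : ∀ B i → P i
  meet B i = subst P eq (proj₂ (D.point B j))
    where
    hit = injective⇒surjective (proj₁ ∘ D.point B) (D.transverse B) i
    j   = proj₁ hit
    eq  = proj₂ hit

  private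
    ∋-meet : ∀ B i → B D.∋ (i , meet B i)
    ∋-meet B i with injective⇒surjective (proj₁ ∘ D.point B) (D.transverse B) i
    ... | j , refl = j , refl

    ∋⇒meet : ∀ {B i x} → B D.∋ (i , x) → meet B i ≡ x
    ∋⇒meet {B} {i} (j , eq) with ∋-meet B i
    ... | j′ , eq′ = ,-injective (trans (sym eq′) (trans (cong (D.point B) j′≡j) eq))
      where
      ,-injective : ∀ {x y : P i} → (i , x) ≡ (i , y) → x ≡ y
      ,-injective refl = refl

      j′≡j = D.transverse B (trans (cong proj₁ eq′) (sym (cong proj₁ eq)))

  Heavy : Fin n → Set
  Heavy i = Σ (P i) (Fin ∘ w i)

  -- The ingredient for `B` lives on the copies of the points of `B`; its i-th group consists of the
  -- copies of the single point `meet B i`.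
  module _ (I : ∀ B → Design k (λ i → Fin (w i (meet B i)))) where
    private
      module I B = Design (I B)

      place : ∀ B → Σ (Fin n) (λ i → Fin (w i (meet B i))) → Σ (Fin n) Heavy
      place B (i , c) = i , meet B i , c

      place-injective : ∀ B → Injective _≡_ _≡_ (place B)
      place-injective B refl = refl

      Block′ : Set
      Block′ = Σ D.Block I.Block

      point′ : Block′ → Fin _ → Σ (Fin n) Heavy
      point′ (B , β) = place B ∘ I.point B β

      _∋′_ : Block′ → Σ (Fin n) Heavy → Set
      β ∋′ x = ∃ λ j → point′ β j ≡ x

      ∋′⇒∋ : ∀ {B β i x c} → (B , β) ∋′ (i , x , c) → B D.∋ (i , x)
      ∋′⇒∋ {B} (j , refl) = ∋-meet B _

      -- The underlying points determine a block `B` of `D`. They must be the points where `B` meets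
      -- their groups, so both copies belong to the ingredient on `B`, which joins them.
      join′ : ∀ x y → proj₁ x ≢ proj₁ y → ∃ λ β → β ∋′ x × β ∋′ y
      join′ (i , x , c) (i′ , x′ , c′) i≢i′ with D.join (i , x) (i′ , x′) i≢i′
      ... | B , B∋x , B∋x′ with ∋⇒meet B∋x | ∋⇒meet B∋x′
      ... | refl | refl =
        let β , (j , eq) , (j′ , eq′) = I.join B (i , c) (i′ , c′) i≢i′ in
        (B , β) , (j , cong (place B) eq) , (j′ , cong (place B) eq′)

      unique′ : ∀ {x y β β′} → proj₁ x ≢ proj₁ y →
                β ∋′ x → β ∋′ y → β′ ∋′ x → β′ ∋′ y → β ≡ β′
      unique′ {β = B , β} {B′ , β′} x≢y β∋x β∋y β′∋x β′∋y
        -- Forgetting the copies recovers the outer block; within it, uniqueness in the ingredient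
        -- settles the inner one.
        with D.unique x≢y (∋′⇒∋ β∋x) (∋′⇒∋ β∋y) (∋′⇒∋ β′∋x) (∋′⇒∋ β′∋y)
      unique′ {β = B , β} {B , β′} x≢y (j , refl) (j′ , refl) (l , eq) (l′ , eq′) | refl =
        cong (B ,_) (I.unique B x≢y (j , refl) (j′ , refl)
          (l , place-injective B eq) (l′ , place-injective B eq′))

    inflation : Design k Heavy
    inflation = record
      { Block      = Block′
      ; enum       = concatMap (λ B → map (B ,_) (I.enum B)) D.enum
      ; complete   = λ (B , β) → ∈-concatMap⁺ _
                       (lose (D.complete B) (∈-map⁺ (B ,_) (I.complete B β)))
      ; inhabitant = D.inhabitant , I.inhabitant _
      ; point      = point′
      ; transverse = λ (B , β) → I.transverse B β
      ; join       = join′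
      ; unique     = unique′
      }

-- Arithmetic

-- Greedy: the first share is as large as `N` and `T` allow, and the remainder `T ∸ N` is at most
-- `q * N`.
distribute : ∀ q N T → T ≤ q * N → ∃ λ (t : Fin q → ℕ) → (∀ i → t i ≤ N) × sum t ≡ T
distribute zero    N T T≤0 = (λ ()) , (λ ()) , sym (n≤0⇒n≡0 T≤0)
distribute (suc q) N T T≤  =
  let t , t≤N , Σt = distribute q N (T ∸ N) (m≤n+o⇒m∸n≤o T N T≤) in
  (λ { zero → N ⊓ T ; (suc i) → t i }) ,
  (λ { zero → m⊓n≤m N T ; (suc i) → t≤N i }) ,
  trans (cong (N ⊓ T +_) Σt) (m⊓n+n∸m≡n N T)

sum-affine : ∀ a b (t : Fin n → ℕ) → sum (λ i → a + t i * b) ≡ n * a + sum t * b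
sum-affine {zero}  a b t = refl
sum-affine {suc n} a b t = trans (cong (a + t zero * b +_) (sum-affine a b (t ∘ suc)))
  (lemma a (t zero) b (n * a) (sum (t ∘ suc)))
  where
  lemma : ∀ a t b x y → a + t * b + (x + y * b) ≡ a + x + (t + y) * b
  lemma = solve-∀

sum-const : ∀ n x → sum {n} (const x) ≡ x * n
sum-const n x = trans (go n) (*-comm n x)
  where
  go : ∀ n → sum {n} (const x) ≡ n * x
  go zero    = refl
  go (suc n) = cong (x +_) (go n)

-- Equal remainders leave only the quotients to differ, so their difference counts the steps of 3.
congruent⇒difference : ∀ {a b} → a ≤ b → b % 3 ≡ a % 3 → ∃ λ t → b ≡ a + t * 3
congruent⇒difference {a} {b} a≤b b≡a = b / 3 ∸ a / 3 , (begin
  b                                         ≡⟨ m≡m%n+[m/n]*n b 3 ⟩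
  b % 3 + b / 3 * 3                         ≡⟨ cong₂ (λ r c → r + c * 3) b≡a (sym (m+[n∸m]≡n (/-monoˡ-≤ 3 a≤b))) ⟩
  a % 3 + (a / 3 + (b / 3 ∸ a / 3)) * 3     ≡⟨ lemma (a % 3) (a / 3) (b / 3 ∸ a / 3) ⟩
  a % 3 + a / 3 * 3 + (b / 3 ∸ a / 3) * 3   ≡⟨ cong (_+ (b / 3 ∸ a / 3) * 3) (m≡m%n+[m/n]*n a 3) ⟨
  a + (b / 3 ∸ a / 3) * 3                   ∎)
  where
  open ≡-Reasoning
  lemma : ∀ r x y → r + (x + y) * 3 ≡ r + x * 3 + y * 3
  lemma = solve-∀

even : ∀ h → (h % 6 ≡ 2) ⊎ (h % 6 ≡ 4) → ∃ λ e → h ≡ e * 2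
even h (inj₁ eq) = 1 + h / 6 * 3 ,
  trans (m≡m%n+[m/n]*n h 6) (trans (cong (_+ h / 6 * 6) eq) (lemma (h / 6)))
  where
  lemma : ∀ c → 2 + c * 6 ≡ (1 + c * 3) * 2
  lemma = solve-∀
even h (inj₂ eq) = 2 + h / 6 * 3 ,
  trans (m≡m%n+[m/n]*n h 6) (trans (cong (_+ h / 6 * 6) eq) (lemma (h / 6)))
  where
  lemma : ∀ c → 4 + c * 6 ≡ (2 + c * 3) * 2
  lemma = solve-∀

halve : ∀ e x → e * 2 * x / 2 ≡ e * x
halve e x = trans (cong (_/ 2) (lemma e x)) (m*n/n≡m (e * x) 2)
  where
  lemma : ∀ e x → e * 2 * x ≡ e * x * 2
  lemma = solve-∀

-- As `u` is divisible by 3, `u ∸ 1` is congruent to 2. With `h = 2e` this puts the upper bound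
-- `h(u-1)/2` in the residue class of `h`, so it is itself an attainable weight.
bound-congruent : ∀ e u → 0 < u → u % 3 ≡ 0 → e * (u ∸ 1) % 3 ≡ e * 2 % 3
bound-congruent e u 0<u u≡0
  with u | u / 3 | trans (m≡m%n+[m/n]*n u 3) (cong (_+ u / 3 * 3) u≡0) | 0<u
-- Here `u` becomes `3 + c * 3`; a zero quotient would contradict `0 < u`.
... | _ | suc c | refl | _ = trans (cong (_% 3) (lemma e c)) ([m+kn]%n≡m%n (e * 2) (e * c) 3)
  where
  lemma : ∀ e c → e * (2 + c * 3) ≡ e * 2 + e * c * 3
  lemma = solve-∀

-- Choice of the weights and assembly of the construction

theorem3p3 : (h u q : ℕ) → 0 < h → 0 < u → 0 < q →
    (h % 6 ≡ 2) ⊎ (h % 6 ≡ 4) →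
    u % 3 ≡ 0 → 6 ≤ u →
    ¬ (3 ∣ q) →
    (u + 1) -GDD-of-type ((q , u + 1) ∷ []) →
    (∀ d → Admissible h u d → 4 -GDD-of-type ((h , u) ∷ (d , 1) ∷ [])) →
    (dmin : ℕ) → IsLeast (Admissible h u) dmin →
    (m : ℕ) → m % 3 ≡ (h * q) % 3 →
    q * dmin ≤ m → m ≤ q * h * (u ∸ 1) / 2 →
    4 -GDD-of-type ((h * q , u) ∷ (m , 1) ∷ [])
theorem3p3 h u q 0<h 0<u 0<q h-even u≡0 _ _ master ingredient dmin (dmin-admissible , _) m m≡hq ≤m m≤
  with even h h-even
... | e , refl = ToGDD.gdd inflated weights nonempty ,
  ↭-trans (↭-reflexive (ToGDD.gdd-sizes inflated weights nonempty))
    (↭-sym (sizes-h^u-d^1 (λ i → sum (w i)) sum-d (λ _ → sum-const q h)))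
  where
  open Admissible dmin-admissible

  dmax : ℕ
  dmax = e * (u ∸ 1)

  -- `N` is the number of steps of 3 from the least weight to the greatest.
  steps : ∃ λ N → dmax ≡ dmin + N * 3
  steps = congruent⇒difference (subst (dmin ≤_) (halve e (u ∸ 1)) bounded)
    (trans (bound-congruent e u 0<u u≡0) (sym congruent))

  N = proj₁ steps

  -- `T` is the number of steps of 3 by which the target exceeds `q` copies of the least weight.
  total : ∃ λ T → m ≡ q * dmin + T * 3
  total = congruent⇒difference ≤m (begin
    m % 3                         ≡⟨ m≡hq ⟩
    h * q % 3                     ≡⟨ %-distribˡ-* h q 3 ⟩
    (h % 3) * (q % 3) % 3         ≡⟨ cong (λ r → r * (q % 3) % 3) congruent ⟨
    (dmin % 3) * (q % 3) % 3      ≡⟨ %-distribˡ-* dmin q 3 ⟨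
    dmin * q % 3                  ≡⟨ cong (_% 3) (*-comm dmin q) ⟩
    q * dmin % 3                  ∎)
    where open ≡-Reasoning

  T = proj₁ total

  -- The upper bound on `m` equals `q * dmax`; subtracting `q * dmin` and dividing by 3 leaves this
  -- inequality.
  T≤qN : T ≤ q * N
  T≤qN = *-cancelʳ-≤ T (q * N) 3 (+-cancelˡ-≤ (q * dmin) _ _ (begin
    q * dmin + T * 3              ≡⟨ proj₂ total ⟨
    m                             ≤⟨ m≤ ⟩
    q * (e * 2) * (u ∸ 1) / 2     ≡⟨ cong (λ x → x * (u ∸ 1) / 2) (*-assoc q e 2) ⟨
    q * e * 2 * (u ∸ 1) / 2       ≡⟨ halve (q * e) (u ∸ 1) ⟩
    q * e * (u ∸ 1)               ≡⟨ *-assoc q e (u ∸ 1) ⟩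
    q * dmax                      ≡⟨ cong (q *_) (proj₂ steps) ⟩
    q * (dmin + N * 3)            ≡⟨ *-distribˡ-+ q dmin (N * 3) ⟩
    q * dmin + q * (N * 3)        ≡⟨ cong (q * dmin +_) (*-assoc q N 3) ⟨
    q * dmin + q * N * 3          ∎))
    where open ≤-Reasoning

  shares = distribute q N T T≤qN
  t = proj₁ shares

  d : Fin q → ℕ
  d x = dmin + t x * 3

  sum-d : sum d ≡ m
  sum-d = trans (sum-affine dmin 3 t)
    (trans (cong (λ T → q * dmin + T * 3) (proj₂ (proj₂ shares))) (sym (proj₂ total)))

  d-admissible : ∀ x → Admissible h u (d x)
  d-admissible x = record
    { positive  = <-≤-trans positive (m≤m+n dmin _)
    ; congruent = trans ([m+kn]%n≡m%n dmin (t x) 3) congruent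
    ; bounded   = begin
        dmin + t x * 3     ≤⟨ +-monoʳ-≤ dmin (*-monoˡ-≤ 3 (proj₁ (proj₂ shares) x)) ⟩
        dmin + N * 3       ≡⟨ proj₂ steps ⟨
        dmax               ≡⟨ halve e (u ∸ 1) ⟨
        h * (u ∸ 1) / 2    ∎
    }
    where open ≤-Reasoning

  -- Writing `suc u` exposes index `zero` as the group that receives the varying weights.
  master′ : suc u -GDD-of-type ((q , suc u) ∷ [])
  master′ = subst (λ k → k -GDD-of-type ((q , k) ∷ [])) (+-comm u 1) master

  transversal : Design (suc u) {suc u} (const (Fin q))
  transversal = FromGDD.design (proj₁ master′) (↭-trans (proj₂ master′) (sizes-const (suc u) q))

  w : Fin (suc u) → Fin q → ℕ
  w zero    x = d x
  w (suc _) x = h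

  open Inflation transversal w

  inflated : Design 4 Heavy
  inflated = inflation λ B →
    -- The weight of the point of `B` in group `zero` selects the ingredient; every other point of
    -- `B` has weight `h`.
    let D , type = ingredient (d (meet B zero)) (d-admissible _) in
    FromGDD.design D (↭-trans type (sizes-h^u-d^1 (λ i → w i (meet B i)) refl (λ _ → refl)))

  weights : ∀ i → Fin (sum (w i)) ↔ Heavy i
  weights i = Σ-Fin↔ (w i)

  nonempty : ∀ i → Heavy i
  -- Positivity of the admissible weights ensures that the first point of the group has a copy.
  nonempty zero    = fromℕ< 0<q , fromℕ< (Admissible.positive (d-admissible _))
  nonempty (suc _) = fromℕ< 0<q , fromℕ< 0<h
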